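{- Let $n$ and $\delta \geq 2$ be integers, and let $g=2k$ with $k \geq 2$ an integer, such that there exists a connected graph on $n$ vertices with minimum degree $\delta$ and girth at least $g$. Let $r(n,\delta,g)$ be the maximum radius of a connected graph on $n$ vertices with minimum degree $\delta$ and girth at least $g$. Then $$r(n,\delta,g) \leq \frac{nk}{2\delta(\delta-1)^{k-2}} + 3k.$$
   Context: Graphs are finite and simple. The girth of a graph is the length of its shortest cycle (infinite if the graph is acyclic). The radius of a connected graph $G$ is $\min_v \max_w d(v,w)$, with $d$ the graph distance. -}

module Defs where

open import Data.Nat using (ℕ; zero; suc; _+_; _*_; _≤_; _<_)
open import Data.Fin using (Fin; inject₁; fromℕ) renaming (zero to fz; suc to fs)
open import Data.Bool using (Bool; true; false; if_then_else_; T)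
open import Data.List using (List; map; allFin)
open import Data.Nat.ListAction using (sum)
open import Data.Empty using (⊥)
open import Data.Product using (Σ; ∃; ∃-syntax; _×_)
open import Relation.Nullary using (¬_)
open import Relation.Binary.PropositionalEquality using (_≡_)
open import Function.Definitions using (Injective)

record Graph (n : ℕ) : Set where
  field
    adj   : Fin n → Fin n → Bool
    sym   : ∀ u v → adj u v ≡ adj v u
    irrefl : ∀ v → adj v v ≡ false

open Graph public

Edge : ∀ {n} → Graph n → Fin n → Fin n → Set
Edge G u v = T (adj G u v)

degree : ∀ {n} → Graph n → Fin n → ℕ
degree {n} G v = sum (map (λ w → if adj G v w then 1 else 0) (allFin n))

MinDegree : ∀ {n} → Graph n → ℕ → Set
MinDegree G δ = (∀ v → δ ≤ degree G v) × (∃[ v ] degree G v ≡ δ)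

data Walk {n} (G : Graph n) : Fin n → Fin n → ℕ → Set where
  here : ∀ v → Walk G v v 0
  step : ∀ {u w v ℓ} → Edge G u w → Walk G w v ℓ → Walk G u v (suc ℓ)

Connected : ∀ {n} → Graph n → Set
Connected G = ∀ u v → ∃[ ℓ ] Walk G u v ℓ

Dist : ∀ {n} → Graph n → Fin n → Fin n → ℕ → Set
Dist G u v d = Walk G u v d × (∀ ℓ → ℓ < d → ¬ Walk G u v ℓ)

Ecc : ∀ {n} → Graph n → Fin n → ℕ → Set
Ecc G v e = (∀ w d → Dist G v w d → d ≤ e) × (∃[ w ] Dist G v w e)

IsRadius : ∀ {n} → Graph n → ℕ → Set
IsRadius G r = (∃[ v ] Ecc G v r) × (∀ v e → Ecc G v e → r ≤ e)

Cycle : ∀ {n} → Graph n → ℕ → Set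
Cycle G zero = ⊥
Cycle {n} G (suc m) =
  2 ≤ m ×
  Σ (Fin (suc m) → Fin n) λ c →
    Injective _≡_ _≡_ c ×
    (∀ (i : Fin m) → Edge G (c (inject₁ i)) (c (fs i))) ×
    Edge G (c (fromℕ m)) (c fz)

GirthAtLeast : ∀ {n} → Graph n → ℕ → Set
GirthAtLeast G g = ∀ ℓ → Cycle G ℓ → g ≤ ℓ

{-# OPTIONS --safe #-}
-- Write h = 2k − 1.  Girth 2k makes the vertices within distance k − 1 of an edge
-- span a tree, so there are at least 2δ(δ−1)^(k−2) of them (the two outermost levels
-- on either side of the edge already suffice), and edges at distance at least h from
-- each other have disjoint such neighbourhoods.  It remains to find m edges that are
-- pairwise that far apart with 2r ≤ 2k(m + 3).
--
-- Let z be a centre, z₀ … z_r a geodesic from z, t = 2h, and y a vertex at distance at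
-- least r from z_t; let y₀ … y_s be a geodesic from z to y and σ = r − s ≤ t.
-- Let d = d(z_i, y_j).  Going from z_t to y through z_i and y_j gives
-- j + σ ≤ |i − t| + d.  If i ≥ t, adding i ≤ j + d yields 2h ≤ 2d; if i ≤ t, adding
-- j ≤ i + d yields 2j + σ ≤ 2h + 2d.  Hence d ≥ h whenever j ≥ a, where 2a + σ ≥ 4h.
-- Take every (2k)-th edge of the first geodesic and, starting from y_a, of the second:
-- since σ + a ≤ 6k, this is enough.
module Submission where

open import Defs
open import Data.Bool using (Bool; true; false; if_then_else_; T)
open import Data.Bool.Properties using (T?)
open import Data.Empty using (⊥-elim)
open import Data.Fin using (Fin; toℕ; inject₁; inject≤; fromℕ) renaming (zero to fz; suc to fs)
open import Data.Fin.Properties using (_≟_; any?; injective⇒≤; inject≤-injective; toℕ-inject≤; toℕ-inject₁; toℕ-fromℕ; toℕ-injective; toℕ<n)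
open import Data.List using (List; []; _∷_; _++_; map; concatMap; filter; allFin; length; lookup; applyUpTo)
open import Data.List.Extrema.Nat using (argmax; f[xs]≤f[argmax])
open import Data.List.Membership.Propositional using (_∈_; _∉_; find)
open import Data.List.Membership.Propositional.Properties using (∈-filter⁻; ∈-concatMap⁻; ∈-++⁻; ∈-lookup; ∈-allFin)
open import Data.List.Properties using (length-++; length-applyUpTo)
open import Data.List.Relation.Binary.Disjoint.Propositional using (Disjoint)
open import Data.List.Relation.Unary.All using (All; []; _∷_)
import Data.List.Relation.Unary.All as All
import Data.List.Relation.Unary.All.Properties as All
open import Data.List.Relation.Unary.AllPairs using (AllPairs; []; _∷_)
import Data.List.Relation.Unary.AllPairs as AllPairs
import Data.List.Relation.Unary.AllPairs.Properties as AllPairs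
open import Data.List.Relation.Unary.Any using (here; there; index)
open import Data.List.Relation.Unary.Any.Properties using (lookup-index)
open import Data.List.Relation.Unary.Unique.Propositional using (Unique)
import Data.List.Relation.Unary.Unique.Propositional.Properties as Unique
open import Data.Nat using (ℕ; zero; suc; _+_; _*_; _∸_; _^_; _≤_; _<_; z≤n; s≤s)
open import Data.Nat.ListAction using (sum)
open import Data.Nat.Properties hiding (_≟_)
open import Data.Nat.Tactic.RingSolver using (solve-∀)
open import Data.Product using (∃-syntax; _×_; _,_; proj₁; proj₂)
open import Data.Sum using (_⊎_; inj₁; inj₂)
open import Data.Unit using (⊤; tt)
open import Function using (_∘_)
open import Relation.Binary.PropositionalEquality as ≡ using (_≡_; _≢_; refl; cong; subst)
open import Relation.Nullary using (¬_; yes; no; ¬?; _×-dec_; contradiction)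
open import Relation.Unary using (Decidable)

-- Counting with duplicate-free lists.

lookup-injective : ∀ {A : Set} {xs : List A} → Unique xs →
  ∀ {i j} → lookup xs i ≡ lookup xs j → i ≡ j
lookup-injective {xs = _ ∷ _} _           {fz}   {fz}   _  = refl
lookup-injective {xs = _ ∷ xs} (x≢ ∷ _)   {fz}   {fs j} eq = contradiction eq (All.lookup x≢ (∈-lookup j))
lookup-injective {xs = _ ∷ xs} (x≢ ∷ _)   {fs i} {fz}   eq = contradiction (≡.sym eq) (All.lookup x≢ (∈-lookup i))
lookup-injective {xs = _ ∷ _} (_ ∷ uniq)  {fs i} {fs j} eq = cong fs (lookup-injective uniq eq)

unique⇒length≤ : ∀ {n} {xs : List (Fin n)} → Unique xs → length xs ≤ n
unique⇒length≤ uniq = injective⇒≤ (lookup-injective uniq)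

-- Serves to turn distinctness of siblings into disjointness of the subtrees below them.
allPairs-from-unique : ∀ {A : Set} {P : A → Set} {R : A → A → Set} →
  (∀ {x y} → P x → P y → x ≢ y → R x y) →
  ∀ {xs} → All P xs → Unique xs → AllPairs R xs
allPairs-from-unique f []         []          = []
allPairs-from-unique f (px ∷ pxs) (x≢ ∷ uniq) =
  All.zipWith (λ { (py , x≢y) → f px py x≢y }) (pxs , x≢) ∷ allPairs-from-unique f pxs uniq

length-concatMap-≥ : ∀ {A B : Set} (f : A → List B) {b} {xs : List A} →
  All (λ x → b ≤ length (f x)) xs → length xs * b ≤ length (concatMap f xs)
length-concatMap-≥ f []              = z≤n
length-concatMap-≥ f {b} {x ∷ xs} (b≤ ∷ bs) =
  ≤-trans (+-mono-≤ b≤ (length-concatMap-≥ f bs)) (≤-reflexive (≡.sym (length-++ (f x))))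

length-filter-T? : ∀ {A : Set} (p : A → Bool) xs →
  length (filter (T? ∘ p) xs) ≡ sum (map (λ x → if p x then 1 else 0) xs)
length-filter-T? p []       = refl
length-filter-T? p (x ∷ xs) with p x
... | true  = cong suc (length-filter-T? p xs)
... | false = length-filter-T? p xs

module _ {n : ℕ} where

  _-_ : List (Fin n) → Fin n → List (Fin n)
  xs - p = filter (λ x → ¬? (x ≟ p)) xs

  length≤length-remove : ∀ {p} xs → All (p ≢_) xs → length xs ≤ length (xs - p)
  length≤length-remove []       []        = z≤n
  length≤length-remove {p} (x ∷ xs) (p≢ ∷ ps) with x ≟ p
  ... | yes x≡p = contradiction (≡.sym x≡p) p≢
  ... | no  _   = s≤s (length≤length-remove xs ps)

  length≤1+length-remove : ∀ p {xs} → Unique xs → length xs ≤ suc (length (xs - p))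
  length≤1+length-remove p []                        = z≤n
  length≤1+length-remove p {x ∷ xs} (x≢ ∷ uniq) with x ≟ p
  ... | yes refl = s≤s (length≤length-remove xs x≢)
  ... | no  _    = s≤s (length≤1+length-remove p uniq)

-- Walks, non-backtracking vertex lists and short cycles.

module _ {n : ℕ} (G : Graph n) where

  edge-sym : ∀ {u v} → Edge G u v → Edge G v u
  edge-sym {u} {v} = subst T (sym G u v)

  edge-irrefl : ∀ {v} → ¬ Edge G v v
  edge-irrefl {v} = subst T (irrefl G v)

  _◅◅_ : ∀ {u v w a b} → Walk G u v a → Walk G v w b → Walk G u w (a + b)
  here _   ◅◅ q = q
  step e p ◅◅ q = step e (p ◅◅ q)

  reverse : ∀ {u v a} → Walk G u v a → Walk G v u a
  reverse (here v) = here v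
  reverse {v = v} (step {u} {ℓ = ℓ} e p) =
    subst (Walk G v u) (+-comm ℓ 1) (reverse p ◅◅ step (edge-sym e) (here u))

  NonBacktracking : List (Fin n) → Set
  NonBacktracking []              = ⊤
  NonBacktracking (x ∷ [])        = ⊤
  NonBacktracking (x ∷ y ∷ [])    = Edge G x y
  NonBacktracking (x ∷ y ∷ z ∷ l) = Edge G x y × x ≢ z × NonBacktracking (y ∷ z ∷ l)

  nb-tail : ∀ {x} l → NonBacktracking (x ∷ l) → NonBacktracking l
  nb-tail []          _            = tt
  nb-tail (_ ∷ [])    _            = tt
  nb-tail (_ ∷ _ ∷ _) (_ , _ , nb) = nb

  nb-head : ∀ {x y} l → NonBacktracking (x ∷ y ∷ l) → Edge G x y
  nb-head []      e           = e
  nb-head (_ ∷ _) (e , _ , _) = e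

  nb-edge : ∀ l → NonBacktracking l → (i j : Fin (length l)) → toℕ j ≡ suc (toℕ i) →
            Edge G (lookup l i) (lookup l j)
  nb-edge (x ∷ y ∷ l) nb fz     (fs fz) _  = nb-head l nb
  nb-edge (x ∷ l)     nb (fs i) (fs j)  eq = nb-edge l (nb-tail l nb) i j (suc-injective eq)

  -- The cycle consists of the vertices after x up to and including its second occurrence.
  nb-return⇒cycle : ∀ {x} l → NonBacktracking (x ∷ l) → Unique l → x ∈ l →
                    ∃[ ℓ ] Cycle G ℓ × ℓ ≤ length l
  nb-return⇒cycle (x ∷ l) nb uniq (here refl) = ⊥-elim (edge-irrefl (nb-head l nb))
  nb-return⇒cycle (y ∷ x ∷ l) (_ , x≢x , _) uniq (there (here refl)) = contradiction refl x≢x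
  nb-return⇒cycle {x} l@(y ∷ z ∷ l′) (xy , _ , nb) uniq x∈l@(there (there x∈l′)) =
    -- The clauses above rule out a loop and an immediate return, so `x` sits at index at least 2
    -- and the cycle has at least three vertices.
    suc m , (s≤s (s≤s z≤n) , c , c-inj , c-edge , c-close) , m<
    where
    m = toℕ (index x∈l)
    m< : suc m ≤ length l
    m< = toℕ<n (index x∈l)
    c : Fin (suc m) → Fin n
    c i = lookup l (inject≤ i m<)
    c-inj : ∀ {i j} → c i ≡ c j → i ≡ j
    c-inj eq = inject≤-injective m< m< _ _ (lookup-injective uniq eq)
    c-edge : ∀ (i : Fin m) → Edge G (c (inject₁ i)) (c (fs i))
    c-edge i = nb-edge l nb _ _ (≡.trans (toℕ-inject≤ (fs i) m<)
      (cong suc (≡.sym (≡.trans (toℕ-inject≤ (inject₁ i) m<) (toℕ-inject₁ i)))))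
    last≡x : c (fromℕ m) ≡ x
    last≡x = ≡.trans
      (cong (lookup l) (toℕ-injective (≡.trans (toℕ-inject≤ (fromℕ m) m<) (toℕ-fromℕ m))))
      (≡.sym (lookup-index x∈l))
    -- The last vertex of the cycle is `x` itself, so the closing edge is the first edge of the
    -- list.
    c-close : Edge G (c (fromℕ m)) (c fz)
    c-close = subst (λ v → Edge G v y) (≡.sym last≡x) xy

  -- Once the tail is known to be duplicate-free, a recurring head closes a cycle inside the tail,
  -- which has fewer than `g` vertices.
  nb⇒unique : ∀ {g} → GirthAtLeast G g → ∀ l → NonBacktracking l → length l ≤ g → Unique l
  nb⇒unique girth []      nb len = []
  nb⇒unique girth (x ∷ l) nb len = All.tabulate x≢ ∷ uniq
    where
    uniq = nb⇒unique girth l (nb-tail l nb) (<⇒≤ len)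
    x≢ : ∀ {y} → y ∈ l → x ≢ y
    x≢ x∈l refl with nb-return⇒cycle l nb uniq x∈l
    ... | ℓ , cyc , ℓ≤ = <-irrefl refl (≤-trans len (≤-trans (girth ℓ cyc) ℓ≤))

  -- Trees growing from the two ends of an edge.

  neighbours : Fin n → List (Fin n)
  neighbours v = filter (T? ∘ adj G v) (allFin n)

  neighbours-unique : ∀ v → Unique (neighbours v)
  neighbours-unique v = Unique.filter⁺ (T? ∘ adj G v) (Unique.allFin⁺ n)

  children : Fin n → Fin n → List (Fin n)
  children p c = neighbours c - p

  children-unique : ∀ p c → Unique (children p c)
  children-unique p c = Unique.filter⁺ (λ x → ¬? (x ≟ p)) (neighbours-unique c)

  ∈-children : ∀ {p c w} → w ∈ children p c → Edge G c w × w ≢ p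
  ∈-children {p} {c} w∈ =
    let w∈nb , w≢p = ∈-filter⁻ (λ x → ¬? (x ≟ p)) {xs = neighbours c} w∈
    in proj₂ (∈-filter⁻ (T? ∘ adj G c) {xs = allFin n} w∈nb) , w≢p

  -- The last two levels of the depth-(L+1) tree rooted at c whose branches leave c away from p.
  tree : Fin n → Fin n → ℕ → List (Fin n)
  tree p c zero    = c ∷ children p c
  tree p c (suc L) = concatMap (λ w → tree c w L) (children p c)

  ∈-tree-suc : ∀ {p c L x} → x ∈ tree p c (suc L) → ∃[ w ] w ∈ children p c × x ∈ tree c w L
  ∈-tree-suc {p} {c} {L} x∈ = find (∈-concatMap⁻ (λ w → tree c w L) {xs = children p c} x∈)

  tree-walk : ∀ L {p c x} → x ∈ tree p c L → ∃[ ℓ ] Walk G c x ℓ × ℓ ≤ suc L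
  tree-walk zero    {c = c}         (here refl) = 0 , here c , z≤n
  tree-walk zero    {p} {x = x} (there x∈)  = 1 , step (proj₁ (∈-children {p} x∈)) (here x) , ≤-refl
  tree-walk (suc L) {p} {c} x∈ =
    let w , w∈ , x∈′ = ∈-tree-suc {p} {c} {L} x∈
        ℓ , q , ℓ≤   = tree-walk L x∈′
    in suc ℓ , step (proj₁ (∈-children {p} w∈)) q , s≤s ℓ≤

  -- The list is the descent from `p` through `c` to `x`; it never backtracks because a child
  -- differs from its grandparent.
  nb-outward : ∀ L {p c x} → Edge G p c → x ∈ tree p c L →
    ∃[ l ] NonBacktracking (p ∷ c ∷ l) × x ∈ c ∷ l × length l ≤ suc L
  nb-outward zero    pc (here refl)  = [] , pc , here refl , z≤n
  nb-outward zero {p} pc (there x∈) =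
    let cx , x≢p = ∈-children {p} x∈
    in _ ∷ [] , (pc , x≢p ∘ ≡.sym , cx) , there (here refl) , s≤s z≤n
  nb-outward (suc L) {p} {c} pc x∈ =
    let w , w∈ , x∈′      = ∈-tree-suc {p} {c} {L} x∈
        cw , w≢p          = ∈-children {p} w∈
        l , nb , x∈l , l≤ = nb-outward L cw x∈′
    in w ∷ l , (pc , w≢p ∘ ≡.sym , nb) , there x∈l , s≤s l≤

  -- The climb from `x` up to `c`, continued along `p ∷ acc`. With `acc` taken from a descent to the
  -- same vertex, it returns to its start.
  nb-inward : ∀ L {p c x y} acc → NonBacktracking (c ∷ p ∷ acc) → x ∈ tree p c L → y ∈ p ∷ acc →
    ∃[ l ] NonBacktracking (x ∷ l) × y ∈ l × length l ≤ suc (suc L) + length acc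
  nb-inward zero {p} acc nb (here refl) y∈ = p ∷ acc , nb , y∈ , n≤1+n _
  nb-inward zero {p} {c} acc nb (there x∈) y∈ =
    let cx , x≢p = ∈-children {p} x∈
    in c ∷ p ∷ acc , (edge-sym cx , x≢p , nb) , there y∈ , ≤-refl
  nb-inward (suc L) {p} {c} acc nb x∈ y∈ =
    let w , w∈ , x∈′       = ∈-tree-suc {p} {c} {L} x∈
        cw , w≢p           = ∈-children {p} w∈
        l , nb′ , y∈l , l≤ = nb-inward L (p ∷ acc) (edge-sym cw , w≢p , nb) x∈′ (there y∈)
    in l , nb′ , y∈l , ≤-trans l≤ (≤-reflexive (+-suc (suc (suc L)) (length acc)))

  -- Distance at least `c`, phrased by walks so that no distance has to be computed.
  Far : ℕ → Fin n → Fin n → Set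
  Far c u v = ∀ ℓ → Walk G u v ℓ → c ≤ ℓ

  _∈ₑ_ : Fin n → Fin n × Fin n → Set
  a ∈ₑ (u , v) = a ≡ u ⊎ a ≡ v

  FarEdges : ℕ → Fin n × Fin n → Fin n × Fin n → Set
  FarEdges c e f = ∀ {a b} → a ∈ₑ e → b ∈ₑ f → Far c a b

  ball : ℕ → Fin n × Fin n → List (Fin n)
  ball L (u , v) = tree v u L ++ tree u v L

  ball-walk : ∀ L {e x} → x ∈ ball L e → ∃[ a ] ∃[ ℓ ] a ∈ₑ e × Walk G a x ℓ × ℓ ≤ suc L
  ball-walk L {u , v} x∈ with ∈-++⁻ (tree v u L) x∈
  ... | inj₁ x∈u = let ℓ , w , ℓ≤ = tree-walk L x∈u in u , ℓ , inj₁ refl , w , ℓ≤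
  ... | inj₂ x∈v = let ℓ , w , ℓ≤ = tree-walk L x∈v in v , ℓ , inj₂ refl , w , ℓ≤

  -- A common vertex would join an end of `e` to an end of `f` by a walk of length at most 2(L+1).
  balls-disjoint : ∀ L {e f} → FarEdges (suc (suc L + suc L)) e f → Disjoint (ball L e) (ball L f)
  balls-disjoint L far (x∈e , x∈f) =
    let a , ℓ , a∈ , p , ℓ≤ = ball-walk L x∈e
        b , m , b∈ , q , m≤ = ball-walk L x∈f
    in <-irrefl refl (≤-trans (far a∈ b∈ _ (p ◅◅ reverse q)) (+-mono-≤ ℓ≤ m≤))

  -- Lower bounds on neighbourhood sizes from the minimum degree.

  module _ {δ : ℕ} (δ≤deg : ∀ v → δ ≤ degree G v) where

    children-length : ∀ p c → δ ∸ 1 ≤ length (children p c)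
    children-length p c = ∸-monoˡ-≤ 1 (≤-trans (δ≤deg c)
      (≤-trans (≤-reflexive (≡.sym (length-filter-T? (adj G c) (allFin n))))
        (length≤1+length-remove p (neighbours-unique c))))

    tree-length : ∀ L p c → δ * (δ ∸ 1) ^ L ≤ length (tree p c L)
    -- The root counts along with its at least δ-1 children; keeping two levels is what gives the
    -- factor δ.
    tree-length zero    p c = ≤-trans (≤-reflexive (*-identityʳ δ))
      (≤-trans (m≤n+m∸n δ 1) (s≤s (children-length p c)))
    tree-length (suc L) p c = begin
      δ * ((δ ∸ 1) * (δ ∸ 1) ^ L)                     ≡⟨ shuffle δ (δ ∸ 1) ((δ ∸ 1) ^ L) ⟩
      (δ ∸ 1) * (δ * (δ ∸ 1) ^ L)                     ≤⟨ *-monoˡ-≤ (δ * (δ ∸ 1) ^ L) (children-length p c) ⟩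
      length (children p c) * (δ * (δ ∸ 1) ^ L)       ≤⟨ length-concatMap-≥ (λ w → tree c w L) {xs = children p c}
                                                           (All.tabulate λ {w} _ → tree-length L c w) ⟩
      length (tree p c (suc L))                       ∎
      where
      open ≤-Reasoning
      shuffle : ∀ a b c → a * (b * c) ≡ b * (a * c)
      shuffle = solve-∀

    ball-length : ∀ L e → 2 * δ * (δ ∸ 1) ^ L ≤ length (ball L e)
    ball-length L (u , v) = begin
      2 * δ * (δ ∸ 1) ^ L                       ≡⟨ split δ ((δ ∸ 1) ^ L) ⟩
      δ * (δ ∸ 1) ^ L + δ * (δ ∸ 1) ^ L         ≤⟨ +-mono-≤ (tree-length L v u) (tree-length L u v) ⟩
      length (tree v u L) + length (tree u v L) ≡⟨ length-++ (tree v u L) ⟨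
      length (ball L (u , v))                   ∎
      where
      open ≤-Reasoning
      split : ∀ a b → 2 * a * b ≡ a * b + a * b
      split = solve-∀

  -- Distinctness of the vertices in a neighbourhood, from the girth.

  module _ {g : ℕ} (girth : GirthAtLeast G g) where

    nb-no-return : ∀ {x l} → NonBacktracking (x ∷ l) → suc (length l) ≤ g → x ∉ l
    nb-no-return nb len = Unique.Unique[x∷xs]⇒x∉xs (nb⇒unique girth _ nb len)

    -- From a common vertex `x`, climb through `w′` to `c` and descend through `w` to `x` again:
    -- since `w ≢ w′` this does not backtrack, and its list has at most 2L+5 entries.
    subtrees-disjoint : ∀ L {c w w′} → 2 * L + 5 ≤ g → Edge G c w → Edge G c w′ → w ≢ w′ →
                        Disjoint (tree c w L) (tree c w′ L)
    subtrees-disjoint L {w = w} bound cw cw′ w≢w′ (x∈w , x∈w′) =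
      let l , nb , x∈l , l≤   = nb-outward L cw x∈w
          l′ , nb′ , x∈l′ , l′≤ = nb-inward L (w ∷ l) (edge-sym cw′ , w≢w′ ∘ ≡.sym , nb) x∈w′ (there x∈l)
      in nb-no-return nb′
           (≤-trans (s≤s (≤-trans l′≤ (+-monoʳ-≤ (suc (suc L)) (s≤s l≤))))
             (≤-trans (≤-reflexive (count L)) bound)) x∈l′
      where
      count : ∀ L → suc (suc (suc L) + suc (suc L)) ≡ 2 * L + 5
      count = solve-∀

    tree-unique : ∀ L {p c} → 2 * L + 3 ≤ g → Unique (tree p c L)
    tree-unique zero {p} {c} bound =
      All.tabulate (λ { {c} c∈ refl → edge-irrefl (proj₁ (∈-children {p} {c} c∈)) }) ∷ children-unique p c
    tree-unique (suc L) {p} {c} bound = Unique.concat⁺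
      (All.map⁺ {xs = children p c} (All.tabulate λ _ → tree-unique L (≤-trans (+-monoˡ-≤ 3 (*-monoʳ-≤ 2 (n≤1+n L))) bound)))
      (AllPairs.map⁺ (allPairs-from-unique
        (subtrees-disjoint L (≤-trans (≤-reflexive (count L)) bound))
        (All.tabulate (λ w∈ → proj₁ (∈-children {p} {c} w∈))) (children-unique p c)))
      where
      count : ∀ L → 2 * L + 5 ≡ 2 * suc L + 3
      count = solve-∀

    -- A vertex on both sides would give a non-backtracking list across the edge that returns to its
    -- start, with at most 2L+4 entries; for k = L+2 this is exactly 2k.
    ball-unique : ∀ L {u v} → 2 * L + 4 ≤ g → Edge G u v → Unique (ball L (u , v))
    ball-unique L {u} {v} bound uv = Unique.++⁺ (tree-unique L bound′) (tree-unique L bound′) disj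
      where
      bound′ = ≤-trans (+-monoʳ-≤ (2 * L) (n≤1+n 3)) bound
      count : ∀ L → suc (suc (suc L) + suc L) ≡ 2 * L + 4
      count = solve-∀
      disj : Disjoint (tree v u L) (tree u v L)
      disj (x∈u , x∈v) =
        let l , nb , x∈l , l≤     = nb-outward L (edge-sym uv) x∈u
            l′ , nb′ , x∈l′ , l′≤ = nb-inward L l nb x∈v x∈l
        in nb-no-return nb′ (≤-trans (s≤s (≤-trans l′≤ (+-monoʳ-≤ (suc (suc L)) l≤)))
             (≤-trans (≤-reflexive (count L)) bound)) x∈l′

  -- The concatenated neighbourhoods form one duplicate-free list of vertices, hence of length at
  -- most `n`.
  packing-bound : ∀ {δ} L → (∀ v → δ ≤ degree G v) → GirthAtLeast G (2 * L + 4) →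
    ∀ {es} → All (λ e → Edge G (proj₁ e) (proj₂ e)) es → AllPairs (FarEdges (suc (suc L + suc L))) es →
    length es * (2 * δ * (δ ∸ 1) ^ L) ≤ n
  packing-bound L δ≤deg girth {es} edges far = ≤-trans
    (length-concatMap-≥ (ball L) {xs = es} (All.tabulate λ {e} _ → ball-length δ≤deg L e))
    (unique⇒length≤ (Unique.concat⁺
      (All.map⁺ (All.map (ball-unique girth L ≤-refl) edges))
      (AllPairs.map⁺ (AllPairs.map (λ {e} {f} → balls-disjoint L {e} {f}) far))))

-- Distances, eccentricities and geodesics.

least : ∀ {P : ℕ → Set} → Decidable P → ∀ m → P m → ∃[ d ] P d × (∀ ℓ → ℓ < d → ¬ P ℓ)
least         P? zero    p = 0 , p , λ _ ()
least {P = P} P? (suc m) p with P? 0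
... | yes p₀ = 0 , p₀ , λ _ ()
... | no ¬p₀ with least (P? ∘ suc) m p
...   | d , pd , below = suc d , pd , below′
  where
  below′ : ∀ ℓ → ℓ < suc d → ¬ P ℓ
  below′ zero    _         = ¬p₀
  below′ (suc ℓ) (s≤s ℓ<d) = below ℓ ℓ<d

module _ {n : ℕ} (G : Graph n) where

  walk? : ∀ u v → Decidable (Walk G u v)
  walk? u v zero with u ≟ v
  ... | yes refl = yes (here u)
  ... | no  u≢v  = no λ { (here _) → u≢v refl }
  walk? u v (suc ℓ) with any? (λ w → T? (adj G u w) ×-dec walk? w v ℓ)
  ... | yes (w , e , p) = yes (step e p)
  ... | no  ∄w          = no λ { (step e p) → ∄w (_ , e , p) }

  dist⇒far : ∀ {u v d} → Dist G u v d → Far G d u v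
  dist⇒far (_ , min) ℓ p = ≮⇒≥ λ ℓ<d → min ℓ ℓ<d p

  module _ (conn : Connected G) where

    distance : ∀ u v → ∃[ d ] Dist G u v d
    distance u v = let ℓ , p = conn u v in least (walk? u v) ℓ p

    eccentricity : ∀ v → ∃[ e ] Ecc G v e
    eccentricity v = dist far , (bound , far , proj₂ (distance v far))
      where
      dist : Fin n → ℕ
      dist = proj₁ ∘ distance v
      -- The default `v` is itself in `allFin n`, so it does not affect the maximum.
      far = argmax dist v (allFin n)
      bound : ∀ w d → Dist G v w d → d ≤ dist far
      bound w d D = ≤-trans (dist⇒far D _ (proj₁ (proj₂ (distance v w))))
        (All.lookup (f[xs]≤f[argmax] v (allFin n)) (∈-allFin w))

  -- Total on ℕ, staying at the endpoint beyond the length, so that indices need no bound until an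
  -- edge or a subwalk is taken.
  vertex : ∀ {u v ℓ} → Walk G u v ℓ → ℕ → Fin n
  vertex {u} p          zero    = u
  vertex     (here v)   (suc _) = v
  vertex     (step e p) (suc i) = vertex p i

  vertex-last : ∀ {u v ℓ} (p : Walk G u v ℓ) → vertex p ℓ ≡ v
  vertex-last (here v)   = refl
  vertex-last (step e p) = vertex-last p

  vertex-edge : ∀ {u v ℓ} (p : Walk G u v ℓ) {i} → i < ℓ → Edge G (vertex p i) (vertex p (suc i))
  vertex-edge (step e p) {zero}  _         = e
  vertex-edge (step e p) {suc i} (s≤s i<ℓ) = vertex-edge p i<ℓ

  segment : ∀ {u v ℓ} (p : Walk G u v ℓ) i d → i + d ≤ ℓ → Walk G (vertex p i) (vertex p (i + d)) d
  segment p          zero    zero    _         = here _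
  segment (step e p) zero    (suc d) (s≤s d≤)  = step e (segment p zero d d≤)
  segment (step e p) (suc i) d       (s≤s i≤)  = segment p i d i≤

  subwalk : ∀ {u v ℓ} (p : Walk G u v ℓ) {i j} → i ≤ j → j ≤ ℓ →
            Walk G (vertex p i) (vertex p j) (j ∸ i)
  subwalk p {i} {j} i≤j j≤ℓ =
    subst (λ x → Walk G (vertex p i) (vertex p x) (j ∸ i)) (m+[n∸m]≡n i≤j)
      (segment p i (j ∸ i) (≤-trans (≤-reflexive (m+[n∸m]≡n i≤j)) j≤ℓ))

  prefix : ∀ {u v ℓ} (p : Walk G u v ℓ) {i} → i ≤ ℓ → Walk G u (vertex p i) i
  prefix p = segment p 0 _

  suffix : ∀ {u v ℓ} (p : Walk G u v ℓ) i f → i + f ≡ ℓ → Walk G (vertex p i) v f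
  suffix p i f refl = subst (λ x → Walk G (vertex p i) x f) (vertex-last p) (segment p i f ≤-refl)

  module Geodesic {u v r} (p : Walk G u v r) (geo : Far G r u v) where

    -- A shortcut to the `i`-th vertex, followed by the rest of `p`, would be shorter than `r`.
    vertex-far : ∀ {i} → i ≤ r → Far G i u (vertex p i)
    vertex-far {i} i≤r ℓ q = +-cancelʳ-≤ (r ∸ i) i ℓ
      (≤-trans (≤-reflexive (m+[n∸m]≡n i≤r)) (geo _ (_◅◅_ G q (suffix p i (r ∸ i) (m+[n∸m]≡n i≤r)))))

    vertices-apart : ∀ {i j d} → i ≤ r → j ≤ r → Walk G (vertex p i) (vertex p j) d → j ≤ i + d
    vertices-apart i≤r j≤r q = vertex-far j≤r _ (_◅◅_ G (prefix p i≤r) q)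

  -- Evenly spaced edges on a geodesic.

  edgeAt : ∀ {u v ℓ} → Walk G u v ℓ → ℕ → Fin n × Fin n
  edgeAt p i = vertex p i , vertex p (suc i)

  ∈-edgeAt : ∀ {u v ℓ} (p : Walk G u v ℓ) i {x} → _∈ₑ_ G x (edgeAt p i) →
             ∃[ j ] x ≡ vertex p j × i ≤ j × j ≤ suc i
  ∈-edgeAt p i (inj₁ eq) = i , eq , ≤-refl , n≤1+n i
  ∈-edgeAt p i (inj₂ eq) = suc i , eq , n≤1+n i , ≤-refl

  module _ {u v r} (p : Walk G u v r) (h b m : ℕ)
           (fits : ∀ {q} → q < m → b + suc h * q < r) where

    spacedEdges : List (Fin n × Fin n)
    spacedEdges = applyUpTo (λ q → edgeAt p (b + suc h * q)) m

    spacedEdges-edges : All (λ e → Edge G (proj₁ e) (proj₂ e)) spacedEdges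
    spacedEdges-edges = All.applyUpTo⁺₁ _ m λ q<m → vertex-edge p (fits q<m)

    -- Each period of h+1 consists of the edge itself and a gap of `h` up to the next one, and a
    -- geodesic admits no shortcut.
    spacedEdges-far : Far G r u v → AllPairs (FarEdges G h) spacedEdges
    spacedEdges-far geo = AllPairs.applyUpTo⁺₁ _ m far
      where
      open Geodesic p geo
      far : ∀ {q q′} → q < q′ → q′ < m →
            FarEdges G h (edgeAt p (b + suc h * q)) (edgeAt p (b + suc h * q′))
      far {q} {q′} q<q′ q′<m x∈ y∈ d w with ∈-edgeAt p _ x∈ | ∈-edgeAt p _ y∈
      ... | i , refl , _ , i≤ | j , refl , ≤j , j≤ =
        +-cancelˡ-≤ (suc (b + suc h * q)) h d (begin
          suc (b + suc h * q) + h  ≡⟨ next b h q ⟩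
          b + suc h * suc q        ≤⟨ +-monoʳ-≤ b (*-monoʳ-≤ (suc h) q<q′) ⟩
          b + suc h * q′           ≤⟨ ≤j ⟩
          j                        ≤⟨ vertices-apart (≤-trans i≤ (fits (<-trans q<q′ q′<m))) (≤-trans j≤ (fits q′<m)) w ⟩
          i + d                    ≤⟨ +-monoˡ-≤ d i≤ ⟩
          suc (b + suc h * q) + d  ∎)
        where
        open ≤-Reasoning
        next : ∀ b h q → suc (b + suc h * q) + h ≡ b + suc h * suc q
        next = solve-∀

-- Halving and rounding.

halve-≤ : ∀ {x y} → x + x ≤ y + y → x ≤ y
halve-≤ {x} {y} le = ≮⇒≥ λ y<x → <⇒≱ (+-mono-< y<x y<x) le

half : ∀ x → ∃[ a ] x ≤ a + a × a + a ≤ suc x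
half zero = 0 , z≤n , z≤n
half (suc zero) = 1 , s≤s z≤n , ≤-refl
half (suc (suc x)) = let a , lo , hi = half x in
  suc a , subst (suc (suc x) ≤_) (cong suc (≡.sym (+-suc a a))) (s≤s (s≤s lo))
        , subst (_≤ suc (suc (suc x))) (cong suc (≡.sym (+-suc a a))) (s≤s (s≤s hi))

-- The first property makes the spaced edges numerous enough, the second makes each of them fit on
-- the geodesic.
ceiling : ∀ c x → ∃[ m ] x ≤ suc c * m × (∀ {q} → q < m → suc c * q < x)
ceiling c zero = 0 , z≤n , λ ()
ceiling c (suc x) with ceiling c x
... | m , x≤ , below with suc x ≤? suc c * m
...   | yes sx≤ = m , sx≤ , λ q<m → m≤n⇒m≤1+n (below q<m)
...   | no  sx≰ = suc m
  , ≤-trans (s≤s x≤) (≤-trans (m≤n+m _ c) (≤-reflexive (more c m)))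
  , λ { (s≤s q≤m) → ≤-trans (s≤s (*-monoʳ-≤ (suc c) q≤m)) (≰⇒> sx≰) }
  where
  more : ∀ c m → c + suc (suc c * m) ≡ suc c * suc m
  more = solve-∀

-- Separation of two geodesics leaving the centre.

module _ {n : ℕ} (G : Graph n) {z w y : Fin n} {r s σ t : ℕ}
         (P : Walk G z w r) (P-geo : Far G r z w) (Q : Walk G z y s) (Q-geo : Far G s z y)
         (s+σ≡r : s + σ ≡ r) (y-far : Far G r (vertex G P t) y) where

  private
    module P = Geodesic G P P-geo
    module Q = Geodesic G Q Q-geo

  detour : ∀ {i j d e} → j ≤ s → Walk G (vertex G P t) (vertex G P i) e →
           Walk G (vertex G P i) (vertex G Q j) d → j + σ ≤ e + d
  detour {j = j} {d} {e} j≤s S X = +-cancelʳ-≤ f (j + σ) (e + d) (begin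
    j + σ + f   ≡⟨ shuffle j σ f ⟩
    j + f + σ   ≡⟨ cong (_+ σ) j+f≡s ⟩
    s + σ       ≡⟨ s+σ≡r ⟩
    r           ≤⟨ y-far _ (_◅◅_ G (_◅◅_ G S X) (suffix G Q j f j+f≡s)) ⟩
    e + d + f   ∎)
    where
    open ≤-Reasoning
    f = s ∸ j
    j+f≡s : j + f ≡ s
    j+f≡s = m+[n∸m]≡n j≤s
    shuffle : ∀ a b c → a + b + c ≡ a + c + b
    shuffle = solve-∀

  -- One bound compares distances from `z`, the other is `detour`. Each contains `d` once, so their
  -- sum bounds 2d and is then halved.
  branches-apart : ∀ {h a i j} → t ≡ h + h → t ≤ r → h + h + (h + h) ≤ a + a + σ →
                   i ≤ r → a ≤ j → j ≤ s → Far G h (vertex G P i) (vertex G Q j)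
  branches-apart {h} {a} {i} {j} t≡ t≤r a-large i≤r a≤j j≤s d X with ≤-total t i
  ... | inj₁ t≤i = halve-≤ (+-cancelˡ-≤ e (h + h) (d + d) (begin
    e + (h + h)   ≡⟨ cong (e +_) t≡ ⟨
    e + t         ≡⟨ m∸n+n≡m t≤i ⟩
    i             ≤⟨ P.vertex-far i≤r _ (_◅◅_ G (prefix G Q j≤s) (reverse G X)) ⟩
    j + d         ≤⟨ +-monoˡ-≤ d (≤-trans (m≤m+n j σ) (detour {i} j≤s (subwalk G P t≤i i≤r) X)) ⟩
    e + d + d     ≡⟨ +-assoc e d d ⟩
    e + (d + d)   ∎))
    where
    open ≤-Reasoning
    e = i ∸ t
  ... | inj₂ i≤t = halve-≤ (+-cancelˡ-≤ (h + h) (h + h) (d + d) (begin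
    h + h + (h + h)   ≤⟨ a-large ⟩
    a + a + σ         ≤⟨ +-monoˡ-≤ σ (+-mono-≤ a≤j a≤j) ⟩
    j + j + σ         ≡⟨ +-assoc j j σ ⟩
    j + (j + σ)       ≤⟨ +-mono-≤ j≤i+d (detour {i} j≤s (reverse G (subwalk G P i≤t t≤r)) X) ⟩
    i + d + (e + d)   ≡⟨ shuffle i d e ⟩
    i + e + (d + d)   ≡⟨ cong (_+ (d + d)) (≡.trans (m+[n∸m]≡n i≤t) t≡) ⟩
    h + h + (d + d)   ∎))
    where
    open ≤-Reasoning
    e = t ∸ i
    j≤i+d : j ≤ i + d
    j≤i+d = Q.vertex-far j≤s _ (_◅◅_ G (prefix G P i≤r) X)
    shuffle : ∀ i d e → i + d + (e + d) ≡ i + e + (d + d)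
    shuffle = solve-∀

-- Many pairwise distant edges in a graph of given radius.

module _ {n : ℕ} (G : Graph n) (conn : Connected G) {r : ℕ} (radius : IsRadius G r) where

  Packing : ℕ → Set
  Packing h =
    ∃[ es ] All (λ e → Edge G (proj₁ e) (proj₂ e)) es × AllPairs (FarEdges G h) es ×
            r + r ≤ suc h * length es + 3 * suc h

  large-radius-packing : ∀ h → h + h ≤ r → Packing h
  large-radius-packing h t≤r =
    es , All.++⁺ (spacedEdges-edges G P h 0 m fitsP) (spacedEdges-edges G Q h a m′ fitsQ)
       , AllPairs.++⁺ (spacedEdges-far G P h 0 m fitsP P-geo) (spacedEdges-far G Q h a m′ fitsQ Q-geo)
           (All.applyUpTo⁺₁ _ m λ q<m → All.applyUpTo⁺₁ _ m′ λ q′<m′ → cross q<m q′<m′)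
       , count
    where
    open ≤-Reasoning
    t = h + h
    z = proj₁ (proj₁ radius)
    z-ecc = proj₂ (proj₁ radius)
    P-dist = proj₂ (proj₂ z-ecc)
    P = proj₁ P-dist
    P-geo = dist⇒far G P-dist
    z′ = vertex G P t
    z′-ecc = proj₂ (eccentricity G conn z′)
    -- A vertex realising the eccentricity of `z′`, which is at least the radius.
    y = proj₁ (proj₂ z′-ecc)
    y-far : Far G r z′ y
    y-far ℓ p = ≤-trans (proj₂ radius z′ _ z′-ecc) (dist⇒far G (proj₂ (proj₂ z′-ecc)) ℓ p)
    s = proj₁ (distance G conn z y)
    Q-dist = proj₂ (distance G conn z y)
    Q = proj₁ Q-dist
    Q-geo = dist⇒far G Q-dist
    σ = r ∸ s
    s+σ≡r : s + σ ≡ r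
    s+σ≡r = m+[n∸m]≡n (proj₁ z-ecc y s Q-dist)
    -- Going back from `z′` to `z` and then along `Q` reaches `y`, so r ≤ t + s.
    σ≤t : σ ≤ t
    σ≤t = m≤n+o⇒m∸n≤o r s (≤-trans (y-far _ (_◅◅_ G (reverse G (prefix G P t≤r)) Q))
                                     (≤-reflexive (+-comm t s)))
    -- Rounded up: the smallest index satisfying `a-large`.
    a = proj₁ (half (t + t ∸ σ))
    a-large : t + t ≤ a + a + σ
    a-large = ≤-trans (≤-reflexive (≡.sym (m∸n+n≡m (≤-trans σ≤t (m≤m+n t t)))))
                      (+-monoˡ-≤ σ (proj₁ (proj₂ (half (t + t ∸ σ)))))
    σ+a≤ : σ + a ≤ 3 * suc h
    σ+a≤ = halve-≤ (begin
      σ + a + (σ + a)            ≡⟨ shuffle σ a ⟩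
      a + a + σ + σ              ≤⟨ +-monoˡ-≤ σ (+-monoˡ-≤ σ (proj₂ (proj₂ (half (t + t ∸ σ))))) ⟩
      suc (t + t ∸ σ + σ) + σ    ≡⟨ cong (λ x → suc x + σ) (m∸n+n≡m (≤-trans σ≤t (m≤m+n t t))) ⟩
      suc (t + t) + σ            ≤⟨ +-monoʳ-≤ (suc (t + t)) σ≤t ⟩
      -- The left side is 6h+1, which falls short of 6(h+1) by 5.
      suc (t + t) + t            ≤⟨ m≤m+n _ 5 ⟩
      suc (t + t) + t + 5        ≡⟨ expand h ⟩
      3 * suc h + 3 * suc h      ∎)
      where
      shuffle : ∀ σ a → σ + a + (σ + a) ≡ a + a + σ + σ
      shuffle = solve-∀
      expand : ∀ h → suc (h + h + (h + h)) + (h + h) + 5 ≡ 3 * suc h + 3 * suc h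
      expand = solve-∀
    m = proj₁ (ceiling h r)
    m-large = proj₁ (proj₂ (ceiling h r))
    fitsP : ∀ {q} → q < m → suc h * q < r
    fitsP = proj₂ (proj₂ (ceiling h r))
    -- If `a` exceeds `s`, truncation gives m′ = 0 and `Q` contributes no edges.
    m′ = proj₁ (ceiling h (s ∸ a))
    m′-large = proj₁ (proj₂ (ceiling h (s ∸ a)))
    fitsQ : ∀ {q} → q < m′ → a + suc h * q < s
    fitsQ q<m′ = ≰⇒> λ s≤ → <⇒≱ (proj₂ (proj₂ (ceiling h (s ∸ a))) q<m′) (m≤n+o⇒m∸n≤o s a s≤)
    es = spacedEdges G P h 0 m fitsP ++ spacedEdges G Q h a m′ fitsQ
    cross : ∀ {q q′} → q < m → q′ < m′ →
            FarEdges G h (edgeAt G P (suc h * q)) (edgeAt G Q (a + suc h * q′))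
    cross q<m q′<m′ x∈ x′∈ with ∈-edgeAt G P _ x∈ | ∈-edgeAt G Q _ x′∈
    ... | i , refl , _ , i≤ | j , refl , ≤j , j≤ =
      branches-apart G P P-geo Q Q-geo s+σ≡r y-far refl t≤r a-large
        (≤-trans i≤ (fitsP q<m)) (≤-trans (m≤m+n a _) ≤j) (≤-trans j≤ (fitsQ q′<m′))
    es-length : length es ≡ m + m′
    es-length = ≡.trans (length-++ (spacedEdges G P h 0 m fitsP))
      (≡.cong₂ _+_ (length-applyUpTo _ m) (length-applyUpTo _ m′))
    count : r + r ≤ suc h * length es + 3 * suc h
    count = begin
      r + r                                       ≡⟨ cong (r +_) s+σ≡r ⟨
      r + (s + σ)                                 ≤⟨ +-mono-≤ m-large (+-monoˡ-≤ σ (≤-trans (m≤n+m∸n s a) (+-monoʳ-≤ a m′-large))) ⟩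
      suc h * m + (a + suc h * m′ + σ)            ≡⟨ shuffle (suc h) m m′ a σ ⟩
      suc h * (m + m′) + (σ + a)                  ≤⟨ +-monoʳ-≤ (suc h * (m + m′)) σ+a≤ ⟩
      suc h * (m + m′) + 3 * suc h                ≡⟨ cong (λ x → suc h * x + 3 * suc h) es-length ⟨
      suc h * length es + 3 * suc h               ∎
      where
      shuffle : ∀ c m m′ a σ → c * m + (a + c * m′ + σ) ≡ c * (m + m′) + (σ + a)
      shuffle = solve-∀

  -- One edge is enough, as 2r ≤ 4h ≤ 4(h+1); a radius walk without edges means r = 0, where the
  -- empty packing works.
  small-radius-packing : ∀ h → r ≤ h + h → Packing h
  small-radius-packing h r≤t with proj₁ (proj₂ (proj₂ (proj₂ (proj₁ radius))))
  ... | here _ = [] , [] , [] , z≤n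
  ... | step {u} {w} e _ = (u , w) ∷ [] , e ∷ [] , [] ∷ [] ,
    ≤-trans (+-mono-≤ r≤t r≤t) (≤-trans (m≤m+n _ 4) (≤-reflexive (expand h)))
    where
    expand : ∀ h → h + h + (h + h) + 4 ≡ suc h * 1 + 3 * suc h
    expand = solve-∀

  packing : ∀ h → Packing h
  packing h with ≤-total (h + h) r
  ... | inj₁ t≤r = large-radius-packing h t≤r
  ... | inj₂ r≤t = small-radius-packing h r≤t

theorem1p2 : (n δ k : ℕ) → 2 ≤ δ → 2 ≤ k →
    (G : Graph n) → Connected G → MinDegree G δ → GirthAtLeast G (2 * k) →
    (r : ℕ) → IsRadius G r →
    r * (2 * δ * (δ ∸ 1) ^ (k ∸ 2)) ≤ n * k + 3 * k * (2 * δ * (δ ∸ 1) ^ (k ∸ 2))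
theorem1p2 n δ k@(suc (suc L)) _ (s≤s (s≤s z≤n)) G conn (δ≤deg , _) girth r radius = begin
  r * M                             ≤⟨ *-monoˡ-≤ M r≤ ⟩
  (length es * k + 3 * k) * M       ≡⟨ shuffle (length es) k M ⟩
  length es * M * k + 3 * k * M     ≤⟨ +-monoˡ-≤ (3 * k * M) (*-monoˡ-≤ k esM≤n) ⟩
  n * k + 3 * k * M                 ∎
  where
  open ≤-Reasoning
  M = 2 * δ * (δ ∸ 1) ^ L
  -- With k = L+2 this is 2k-1, so the period `suc h` is 2k and halving the packing inequality
  -- leaves the factor `k`.
  h = suc (suc L + suc L)
  pack = packing G conn radius h
  es = proj₁ pack
  esM≤n : length es * M ≤ n
  esM≤n = packing-bound G L δ≤deg (subst (GirthAtLeast G) (double L) girth)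
    (proj₁ (proj₂ pack)) (proj₁ (proj₂ (proj₂ pack)))
    where
    double : ∀ L → 2 * suc (suc L) ≡ 2 * L + 4
    double = solve-∀
  r≤ : r ≤ length es * k + 3 * k
  r≤ = halve-≤ (≤-trans (proj₂ (proj₂ (proj₂ pack))) (≤-reflexive (regroup L (length es))))
    where
    regroup : ∀ L m → suc (suc (suc L + suc L)) * m + 3 * suc (suc (suc L + suc L)) ≡
                      m * suc (suc L) + 3 * suc (suc L) + (m * suc (suc L) + 3 * suc (suc L))
    regroup = solve-∀
  shuffle : ∀ m k M → (m * k + 3 * k) * M ≡ m * M * k + 3 * k * M
  shuffle = solve-∀
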